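{- Let $A,B,B',C,C'\in\widehat{\mathbb{F}_q}$ and $x,y\in\mathbb{F}_q$. If $x\neq 1$, then $$F_{2}(A;B,B';C,C';x,y)=C(-1)\,\overline{A}(1-x)\,F_{2}\left(A;\overline{B}C,B';C,C';-\frac{x}{1-x},\frac{y}{1-x}\right).$$ If $y\neq 1$, then $$F_{2}(A;B,B';C,C';x,y)=C'(-1)\,\overline{A}(1-y)\,F_{2}\left(A;B,\overline{B'}C';C,C';\frac{x}{1-y},-\frac{y}{1-y}\right).$$ If $x+y\neq 1$, then $$F_{2}(A;B,B';C,C';x,y)=CC'(-1)\,\overline{A}(1-x-y)\,F_{2}\left(A;\overline{B}C,\overline{B'}C';C,C';-\frac{x}{1-x-y},-\frac{y}{1-x-y}\right).$$
   Context: Let $q$ be a power of a prime, $\mathbb{F}_q$ the field with $q$ elements, and $\widehat{\mathbb{F}_q}$ the group of (complex-valued) multiplicative characters of $\mathbb{F}_q^*$. Every character $\chi$, including the trivial character $\varepsilon$, is extended to $\mathbb{F}_q$ by $\chi(0)=0$. $\overline{\chi}$ denotes the inverse of $\chi$. Products of characters are evaluated pointwise, e.g. $CC'(-1)=C(-1)C'(-1)$. The finite field Appell series $F_2$ is defined, for $A,B,B',C,C'\in\widehat{\mathbb{F}_q}$ and $x,y\in\mathbb{F}_q$, by $$F_{2}(A;B,B';C,C';x,y)=\varepsilon(xy)\,BB'CC'(-1)\sum_{u,v\in\mathbb{F}_q}B(u)B'(v)\,\overline{B}C(1-u)\,\overline{B'}C'(1-v)\,\overline{A}(1-ux-vy).$$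 -}

module Defs where

open import Algebra.Bundles using (CommutativeRing; AbelianGroup)
import Algebra.Construct.DirectProduct as DirectProduct
open import Algebra.Definitions using (Invertible)
open import Algebra.Morphism.Structures using (module GroupMorphisms)
import Algebra.Properties.AbelianGroup as AbelianGroupProperties
import Algebra.Properties.CommutativeMonoid.Sum as Sum
import Algebra.Properties.CommutativeSemigroup as CommutativeSemigroupProperties
open import Data.Fin.Base using (Fin)
import Data.Fin.Properties as Fin
open import Data.Nat.Base as ℕ using (ℕ)
import Data.Nat.Properties as ℕ
open import Data.Nat.Primality using (Prime)
open import Data.Product.Base using (∃; ∃-syntax; ∃₂; _×_; _,_; proj₁; proj₂)
open import Data.Rational.Base as ℚ using (ℚ; 0ℚ; 1ℚ; ½)
import Data.Rational.Properties as ℚ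
import Data.Rational.Solver as ℚSolver
open import Function.Bundles using (Inverse)
open import Function.Construct.Symmetry using (inverse)
open import Function.Properties.Inverse using (Inverse⇒Injection)
open import Level using (Level; _⊔_; suc; 0ℓ)
open import Relation.Binary.Definitions using (Decidable)
open import Relation.Binary.PropositionalEquality as ≡ using (_≡_)
open import Relation.Nullary.Decidable using (yes; no; via-injection)
open import Relation.Nullary.Negation using (¬_)

-- Reals are Cauchy sequences of rationals (the modulus being part of the
-- data), equal when their difference tends to 0.  Convergence to 0 is
-- developed once for two index sets: ℕ, for equality of reals, and ℕ × ℕ,
-- for the Cauchy condition.  "N ≼ i" reads "the index i lies beyond N".

module Limits {I : Set} (_≼_ : ℕ → I → Set)
              (weaken : ∀ {M N i} → M ℕ.≤ N → N ≼ i → M ≼ i) where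

  open import Data.Rational.Base using (_+_; _*_; -_; _<_; _≤_; ∣_∣)

  Vanishing : (I → ℚ) → Set
  Vanishing f = ∀ ε → 0ℚ < ε → ∃[ N ] (∀ i → N ≼ i → ∣ f i ∣ < ε)

  Bounded : (I → ℚ) → Set
  Bounded f = ∃[ B ] (0ℚ < B × ∃[ N ] (∀ i → N ≼ i → ∣ f i ∣ ≤ B))

  vanishing-resp : ∀ {f g} → (∀ i → f i ≡ g i) → Vanishing f → Vanishing g
  vanishing-resp f≡g vf ε 0<ε with vf ε 0<ε
  ... | N , p = N , λ i N≼i → ≡.subst (λ t → ∣ t ∣ < ε) (f≡g i) (p i N≼i)

  vanishing-0 : ∀ {f} → (∀ i → f i ≡ 0ℚ) → Vanishing f
  vanishing-0 f≡0 ε 0<ε =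
    0 , λ i _ → ≡.subst (λ t → ∣ t ∣ < ε) (≡.sym (f≡0 i)) 0<ε

  vanishing-neg : ∀ {f} → Vanishing f → Vanishing (λ i → - f i)
  vanishing-neg {f} vf ε 0<ε with vf ε 0<ε
  ... | N , p = N , λ i N≼i → ≡.subst (_< ε) (≡.sym (ℚ.∣-p∣≡∣p∣ (f i))) (p i N≼i)

  vanishing-+ : ∀ {f g} → Vanishing f → Vanishing g → Vanishing (λ i → f i + g i)
  vanishing-+ {f} {g} vf vg ε 0<ε with vf (½ * ε) 0<½ε | vg (½ * ε) 0<½ε
    where
    0<½ε : 0ℚ < ½ * ε
    0<½ε = ≡.subst (_< ½ * ε) (ℚ.*-zeroʳ ½) (ℚ.*-monoʳ-<-pos ½ 0<ε)
  ... | M , p | N , q = M ℕ.⊔ N , λ i ≼i → begin-strict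
    ∣ f i + g i ∣       ≤⟨ ℚ.∣p+q∣≤∣p∣+∣q∣ (f i) (g i) ⟩
    ∣ f i ∣ + ∣ g i ∣   <⟨ ℚ.+-mono-< (p i (weaken (ℕ.m≤m⊔n M N) ≼i))
                                      (q i (weaken (ℕ.m≤n⊔m M N) ≼i)) ⟩
    ½ * ε + ½ * ε       ≡⟨ ℚ.*-distribʳ-+ ε ½ ½ ⟨
    1ℚ * ε              ≡⟨ ℚ.*-identityˡ ε ⟩
    ε                   ∎
    where open ℚ.≤-Reasoning

  vanishing-* : ∀ {f g} → Bounded f → Vanishing g → Vanishing (λ i → f i * g i)
  vanishing-* {f} {g} (B , 0<B , M , p) vg ε 0<ε = M ℕ.⊔ N , λ i ≼i → begin-strict
    ∣ f i * g i ∣       ≡⟨ ℚ.∣p*q∣≡∣p∣*∣q∣ (f i) (g i) ⟩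
    ∣ f i ∣ * ∣ g i ∣   ≤⟨ ℚ.*-monoʳ-≤-nonNeg ∣ g i ∣ {{ℚ.∣-∣-nonNeg (g i)}}
                             (p i (weaken (ℕ.m≤m⊔n M N) ≼i)) ⟩
    B * ∣ g i ∣         <⟨ ℚ.*-monoʳ-<-pos B (q i (weaken (ℕ.m≤n⊔m M N) ≼i)) ⟩
    B * (B⁻¹ * ε)       ≡⟨ ℚ.*-assoc B B⁻¹ ε ⟨
    (B * B⁻¹) * ε       ≡⟨ ≡.cong (_* ε) (ℚ.*-inverseʳ B) ⟩
    1ℚ * ε              ≡⟨ ℚ.*-identityˡ ε ⟩
    ε                   ∎
    where
    open ℚ.≤-Reasoning
    instance
      B>0 : ℚ.Positive B
      B>0 = ℚ.positive 0<B
      B≢0 : ℚ.NonZero B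
      B≢0 = ℚ.pos⇒nonZero B
    B⁻¹ : ℚ
    B⁻¹ = ℚ.1/ B
    instance
      B⁻¹>0 : ℚ.Positive B⁻¹
      B⁻¹>0 = ℚ.1/pos⇒pos B
    0<B⁻¹ε : 0ℚ < B⁻¹ * ε
    0<B⁻¹ε = ≡.subst (_< B⁻¹ * ε) (ℚ.*-zeroʳ B⁻¹) (ℚ.*-monoʳ-<-pos B⁻¹ 0<ε)
    N : ℕ
    N = proj₁ (vg (B⁻¹ * ε) 0<B⁻¹ε)
    q : ∀ i → N ≼ i → ∣ g i ∣ < B⁻¹ * ε
    q with vg (B⁻¹ * ε) 0<B⁻¹ε
    ... | _ , r = r

_≤₂_ : ℕ → ℕ × ℕ → Set
N ≤₂ (m , n) = N ℕ.≤ m × N ℕ.≤ n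

module Lim  = Limits ℕ._≤_ ℕ.≤-trans
module Lim₂ = Limits _≤₂_ (λ M≤N (N≤m , N≤n) → ℕ.≤-trans M≤N N≤m , ℕ.≤-trans M≤N N≤n)

IsCauchy : (ℕ → ℚ) → Set
IsCauchy a = Lim₂.Vanishing (λ (m , n) → a m ℚ.- a n)

record ℝ : Set where
  constructor real
  field
    seq    : ℕ → ℚ
    cauchy : IsCauchy seq

open ℝ public

module Real where

  open ℚSolver.+-*-Solver using (solve; _:+_; _:*_; _:-_; :-_; con; _:=_)

  infix  4 _≈_
  infixl 6 _+_
  infixl 7 _*_
  infix  8 -_

  _≈_ : ℝ → ℝ → Set
  x ≈ y = Lim.Vanishing (λ n → seq x n ℚ.- seq y n)

  bounded : ∀ x → Lim.Bounded (seq x)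
  bounded x with cauchy x 1ℚ (ℚ.positive⁻¹ 1ℚ)
  ... | N , p = B , 0<B , N , λ n N≤n → begin
    ℚ.∣ a n ∣                               ≡⟨ ≡.cong ℚ.∣_∣ (split (a n) (a N)) ⟩
    ℚ.∣ a N ℚ.+ (a n ℚ.- a N) ∣             ≤⟨ ℚ.∣p+q∣≤∣p∣+∣q∣ (a N) (a n ℚ.- a N) ⟩
    ℚ.∣ a N ∣ ℚ.+ ℚ.∣ a n ℚ.- a N ∣         ≤⟨ ℚ.+-monoʳ-≤ ℚ.∣ a N ∣
                                                 (ℚ.<⇒≤ (p (n , N) (N≤n , ℕ.≤-refl))) ⟩
    B                                       ∎
    where
    open ℚ.≤-Reasoning
    a : ℕ → ℚ
    a = seq x
    B : ℚ
    B = ℚ.∣ a N ∣ ℚ.+ 1ℚ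
    0<B : 0ℚ ℚ.< B
    0<B = ℚ.+-mono-≤-< (ℚ.0≤∣p∣ (a N)) (ℚ.positive⁻¹ 1ℚ)
    split : ∀ s t → s ≡ t ℚ.+ (s ℚ.- t)
    split = solve 2 (λ s t → s := t :+ (s :- t)) ≡.refl

  _+_ : ℝ → ℝ → ℝ
  x + y = real (λ n → seq x n ℚ.+ seq y n)
    (Lim₂.vanishing-resp
      (λ (m , n) → lemma (seq x m) (seq x n) (seq y m) (seq y n))
      (Lim₂.vanishing-+ (cauchy x) (cauchy y)))
    where
    lemma : ∀ a b c d → (a ℚ.- b) ℚ.+ (c ℚ.- d) ≡ (a ℚ.+ c) ℚ.- (b ℚ.+ d)
    lemma = solve 4 (λ a b c d → (a :- b) :+ (c :- d) := (a :+ c) :- (b :+ d)) ≡.refl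

  -_ : ℝ → ℝ
  - x = real (λ n → ℚ.- seq x n)
    (Lim₂.vanishing-resp (λ (m , n) → lemma (seq x m) (seq x n))
      (Lim₂.vanishing-neg (cauchy x)))
    where
    lemma : ∀ a b → ℚ.- (a ℚ.- b) ≡ (ℚ.- a) ℚ.- (ℚ.- b)
    lemma = solve 2 (λ a b → :- (a :- b) := (:- a) :- (:- b)) ≡.refl

  _*_ : ℝ → ℝ → ℝ
  x * y = real (λ n → seq x n ℚ.* seq y n)
    (Lim₂.vanishing-resp
      (λ (m , n) → lemma (seq x m) (seq x n) (seq y m) (seq y n))
      (Lim₂.vanishing-+ (Lim₂.vanishing-* (fst (bounded x)) (cauchy y))
                        (Lim₂.vanishing-* (snd (bounded y)) (cauchy x))))
    where
    fst : ∀ {a} → Lim.Bounded a → Lim₂.Bounded (λ (m , n) → a m)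
    fst (B , 0<B , N , p) = B , 0<B , N , λ (m , n) (N≤m , _) → p m N≤m
    snd : ∀ {a} → Lim.Bounded a → Lim₂.Bounded (λ (m , n) → a n)
    snd (B , 0<B , N , p) = B , 0<B , N , λ (m , n) (_ , N≤n) → p n N≤n
    lemma : ∀ a b c d → a ℚ.* (c ℚ.- d) ℚ.+ d ℚ.* (a ℚ.- b) ≡ a ℚ.* c ℚ.- b ℚ.* d
    lemma = solve 4 (λ a b c d → a :* (c :- d) :+ d :* (a :- b) := a :* c :- b :* d) ≡.refl

  fromℚ : ℚ → ℝ
  fromℚ r = real (λ _ → r) (Lim₂.vanishing-0 (λ _ → ℚ.+-inverseʳ r))

  pointwise : ∀ {x y} → (∀ n → seq x n ≡ seq y n) → x ≈ y
  pointwise {x} {y} x≡y = Lim.vanishing-0 λ n →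
    ≡.trans (≡.cong (ℚ._- seq y n) (x≡y n)) (ℚ.+-inverseʳ (seq y n))

  ≈-sym : ∀ {x y} → x ≈ y → y ≈ x
  ≈-sym {x} {y} x≈y = Lim.vanishing-resp (λ n → lemma (seq x n) (seq y n))
    (Lim.vanishing-neg x≈y)
    where
    lemma : ∀ a b → ℚ.- (a ℚ.- b) ≡ b ℚ.- a
    lemma = solve 2 (λ a b → :- (a :- b) := b :- a) ≡.refl

  ≈-trans : ∀ {x y z} → x ≈ y → y ≈ z → x ≈ z
  ≈-trans {x} {y} {z} x≈y y≈z = Lim.vanishing-resp
    (λ n → lemma (seq x n) (seq y n) (seq z n)) (Lim.vanishing-+ x≈y y≈z)
    where
    lemma : ∀ a b c → (a ℚ.- b) ℚ.+ (b ℚ.- c) ≡ a ℚ.- c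
    lemma = solve 3 (λ a b c → (a :- b) :+ (b :- c) := a :- c) ≡.refl

  +-cong : ∀ {x y u v} → x ≈ y → u ≈ v → x + u ≈ y + v
  +-cong {x} {y} {u} {v} x≈y u≈v = Lim.vanishing-resp
    (λ n → lemma (seq x n) (seq y n) (seq u n) (seq v n)) (Lim.vanishing-+ x≈y u≈v)
    where
    lemma : ∀ a b c d → (a ℚ.- b) ℚ.+ (c ℚ.- d) ≡ (a ℚ.+ c) ℚ.- (b ℚ.+ d)
    lemma = solve 4 (λ a b c d → (a :- b) :+ (c :- d) := (a :+ c) :- (b :+ d)) ≡.refl

  -‿cong : ∀ {x y} → x ≈ y → - x ≈ - y
  -‿cong {x} {y} x≈y = Lim.vanishing-resp (λ n → lemma (seq x n) (seq y n))
    (Lim.vanishing-neg x≈y)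
    where
    lemma : ∀ a b → ℚ.- (a ℚ.- b) ≡ (ℚ.- a) ℚ.- (ℚ.- b)
    lemma = solve 2 (λ a b → :- (a :- b) := (:- a) :- (:- b)) ≡.refl

  *-cong : ∀ {x y u v} → x ≈ y → u ≈ v → x * u ≈ y * v
  *-cong {x} {y} {u} {v} x≈y u≈v = Lim.vanishing-resp
    (λ n → lemma (seq x n) (seq y n) (seq u n) (seq v n))
    (Lim.vanishing-+ (Lim.vanishing-* (bounded x) u≈v) (Lim.vanishing-* (bounded v) x≈y))
    where
    lemma : ∀ a b c d → a ℚ.* (c ℚ.- d) ℚ.+ d ℚ.* (a ℚ.- b) ≡ a ℚ.* c ℚ.- b ℚ.* d
    lemma = solve 4 (λ a b c d → a :* (c :- d) :+ d :* (a :- b) := a :* c :- b :* d) ≡.refl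

  commutativeRing : CommutativeRing 0ℓ 0ℓ
  commutativeRing = record
    { _≈_ = _≈_ ; _+_ = _+_ ; _*_ = _*_ ; -_ = -_ ; 0# = fromℚ 0ℚ ; 1# = fromℚ 1ℚ
    ; isCommutativeRing = record
      { isRing = record
        { +-isAbelianGroup = record
          { isGroup = record
            { isMonoid = record
              { isSemigroup = record
                { isMagma = record
                  { isEquivalence = record
                    { refl  = λ {x} → pointwise {x} {x} (λ _ → ≡.refl)
                    ; sym   = λ {x} {y} → ≈-sym {x} {y}
                    ; trans = λ {x} {y} {z} → ≈-trans {x} {y} {z}
                    }
                  ; ∙-cong = λ {x} {y} {u} {v} → +-cong {x} {y} {u} {v}
                  }
                ; assoc = λ x y z → pointwise {(x + y) + z} {x + (y + z)}
                    (λ n → ℚ.+-assoc (seq x n) (seq y n) (seq z n))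
                }
              ; identity =
                  (λ x → pointwise {fromℚ 0ℚ + x} {x} (λ n → ℚ.+-identityˡ (seq x n)))
                , (λ x → pointwise {x + fromℚ 0ℚ} {x} (λ n → ℚ.+-identityʳ (seq x n)))
              }
            ; inverse =
                (λ x → pointwise {(- x) + x} {fromℚ 0ℚ} (λ n → ℚ.+-inverseˡ (seq x n)))
              , (λ x → pointwise {x + (- x)} {fromℚ 0ℚ} (λ n → ℚ.+-inverseʳ (seq x n)))
            ; ⁻¹-cong = λ {x} {y} → -‿cong {x} {y}
            }
          ; comm = λ x y → pointwise {x + y} {y + x}
              (λ n → ℚ.+-comm (seq x n) (seq y n))
          }
        ; *-cong = λ {x} {y} {u} {v} → *-cong {x} {y} {u} {v}
        ; *-assoc = λ x y z → pointwise {(x * y) * z} {x * (y * z)}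
            (λ n → ℚ.*-assoc (seq x n) (seq y n) (seq z n))
        ; *-identity =
            (λ x → pointwise {fromℚ 1ℚ * x} {x} (λ n → ℚ.*-identityˡ (seq x n)))
          , (λ x → pointwise {x * fromℚ 1ℚ} {x} (λ n → ℚ.*-identityʳ (seq x n)))
        ; distrib =
            (λ x y z → pointwise {x * (y + z)} {x * y + x * z}
              (λ n → ℚ.*-distribˡ-+ (seq x n) (seq y n) (seq z n)))
          , (λ x y z → pointwise {(y + z) * x} {y * x + z * x}
              (λ n → ℚ.*-distribʳ-+ (seq x n) (seq y n) (seq z n)))
        }
      ; *-comm = λ x y → pointwise {x * y} {y * x}
          (λ n → ℚ.*-comm (seq x n) (seq y n))
      }
    }

-- The pair (a , b) is a + bi.

module Complex where

  open Real using (pointwise)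
  open ℚSolver.+-*-Solver using (solve; _:+_; _:*_; _:-_; con; _:=_)
  private
    module ℝR = CommutativeRing Real.commutativeRing
    module +ℂ = AbelianGroup
      (DirectProduct.abelianGroup ℝR.+-abelianGroup ℝR.+-abelianGroup)

  ℂ : Set
  ℂ = ℝ × ℝ

  infixl 7 _*_

  _*_ : ℂ → ℂ → ℂ
  (a , b) * (c , d) = (a ℝR.* c) ℝR.- (b ℝR.* d) , (a ℝR.* d) ℝR.+ (b ℝR.* c)

  1ℂ : ℂ
  1ℂ = ℝR.1# , ℝR.0#

  *-cong : ∀ {z w u v} → z +ℂ.≈ w → u +ℂ.≈ v → (z * u) +ℂ.≈ (w * v)
  *-cong {a , b} {a′ , b′} {c , d} {c′ , d′} (p , q) (r , s) =
      ℝR.+-cong {a ℝR.* c} {a′ ℝR.* c′} {ℝR.- (b ℝR.* d)} {ℝR.- (b′ ℝR.* d′)}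
        (ℝR.*-cong {a} {a′} {c} {c′} p r)
        (ℝR.-‿cong {b ℝR.* d} {b′ ℝR.* d′} (ℝR.*-cong {b} {b′} {d} {d′} q s))
    , ℝR.+-cong {a ℝR.* d} {a′ ℝR.* d′} {b ℝR.* c} {b′ ℝR.* c′}
        (ℝR.*-cong {a} {a′} {d} {d′} p s) (ℝR.*-cong {b} {b′} {c} {c′} q r)

  *-comm : ∀ z w → (z * w) +ℂ.≈ (w * z)
  *-comm z@(a , b) w@(c , d) =
      pointwise {proj₁ (z * w)} {proj₁ (w * z)}
        (λ n → re (seq a n) (seq b n) (seq c n) (seq d n))
    , pointwise {(a ℝR.* d) ℝR.+ (b ℝR.* c)} {(c ℝR.* b) ℝR.+ (d ℝR.* a)}
        (λ n → im (seq a n) (seq b n) (seq c n) (seq d n))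
    where
    re : ∀ a b c d → a ℚ.* c ℚ.- b ℚ.* d ≡ c ℚ.* a ℚ.- d ℚ.* b
    re = solve 4 (λ a b c d → a :* c :- b :* d := c :* a :- d :* b) ≡.refl
    im : ∀ a b c d → a ℚ.* d ℚ.+ b ℚ.* c ≡ c ℚ.* b ℚ.+ d ℚ.* a
    im = solve 4 (λ a b c d → a :* d :+ b :* c := c :* b :+ d :* a) ≡.refl

  *-assoc : ∀ z w v → ((z * w) * v) +ℂ.≈ (z * (w * v))
  *-assoc z@(a , b) w@(c , d) v@(e , f) =
      pointwise {proj₁ ((z * w) * v)} {proj₁ (z * (w * v))}
        (λ n → re (seq a n) (seq b n) (seq c n) (seq d n) (seq e n) (seq f n))
    , pointwise {proj₂ ((z * w) * v)} {proj₂ (z * (w * v))}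
        (λ n → im (seq a n) (seq b n) (seq c n) (seq d n) (seq e n) (seq f n))
    where
    re : ∀ a b c d e f →
         (a ℚ.* c ℚ.- b ℚ.* d) ℚ.* e ℚ.- (a ℚ.* d ℚ.+ b ℚ.* c) ℚ.* f ≡
         a ℚ.* (c ℚ.* e ℚ.- d ℚ.* f) ℚ.- b ℚ.* (c ℚ.* f ℚ.+ d ℚ.* e)
    re = solve 6 (λ a b c d e f →
         (a :* c :- b :* d) :* e :- (a :* d :+ b :* c) :* f :=
         a :* (c :* e :- d :* f) :- b :* (c :* f :+ d :* e)) ≡.refl
    im : ∀ a b c d e f →
         (a ℚ.* c ℚ.- b ℚ.* d) ℚ.* f ℚ.+ (a ℚ.* d ℚ.+ b ℚ.* c) ℚ.* e ≡
         a ℚ.* (c ℚ.* f ℚ.+ d ℚ.* e) ℚ.+ b ℚ.* (c ℚ.* e ℚ.- d ℚ.* f)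
    im = solve 6 (λ a b c d e f →
         (a :* c :- b :* d) :* f :+ (a :* d :+ b :* c) :* e :=
         a :* (c :* f :+ d :* e) :+ b :* (c :* e :- d :* f)) ≡.refl

  *-identityˡ : ∀ z → (1ℂ * z) +ℂ.≈ z
  *-identityˡ z@(a , b) =
      pointwise {proj₁ (1ℂ * z)} {a} (λ n → re (seq a n) (seq b n))
    , pointwise {proj₂ (1ℂ * z)} {b} (λ n → im (seq a n) (seq b n))
    where
    re : ∀ a b → 1ℚ ℚ.* a ℚ.- 0ℚ ℚ.* b ≡ a
    re = solve 2 (λ a b → con 1ℚ :* a :- con 0ℚ :* b := a) ≡.refl
    im : ∀ a b → 1ℚ ℚ.* b ℚ.+ 0ℚ ℚ.* a ≡ b
    im = solve 2 (λ a b → con 1ℚ :* b :+ con 0ℚ :* a := b) ≡.refl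

  distribˡ : ∀ z w v → (z * (w +ℂ.∙ v)) +ℂ.≈ ((z * w) +ℂ.∙ (z * v))
  distribˡ z@(a , b) w@(c , d) v@(e , f) =
      pointwise {proj₁ (z * (w +ℂ.∙ v))} {proj₁ ((z * w) +ℂ.∙ (z * v))}
        (λ n → re (seq a n) (seq b n) (seq c n) (seq d n) (seq e n) (seq f n))
    , pointwise {proj₂ (z * (w +ℂ.∙ v))}
                {proj₂ ((z * w) +ℂ.∙ (z * v))}
        (λ n → im (seq a n) (seq b n) (seq c n) (seq d n) (seq e n) (seq f n))
    where
    re : ∀ a b c d e f →
         a ℚ.* (c ℚ.+ e) ℚ.- b ℚ.* (d ℚ.+ f) ≡
         (a ℚ.* c ℚ.- b ℚ.* d) ℚ.+ (a ℚ.* e ℚ.- b ℚ.* f)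
    re = solve 6 (λ a b c d e f →
         a :* (c :+ e) :- b :* (d :+ f) :=
         (a :* c :- b :* d) :+ (a :* e :- b :* f)) ≡.refl
    im : ∀ a b c d e f →
         a ℚ.* (d ℚ.+ f) ℚ.+ b ℚ.* (c ℚ.+ e) ≡
         (a ℚ.* d ℚ.+ b ℚ.* c) ℚ.+ (a ℚ.* f ℚ.+ b ℚ.* e)
    im = solve 6 (λ a b c d e f →
         a :* (d :+ f) :+ b :* (c :+ e) :=
         (a :* d :+ b :* c) :+ (a :* f :+ b :* e)) ≡.refl

  commutativeRing : CommutativeRing 0ℓ 0ℓ
  commutativeRing = record
    { Carrier = ℂ
    ; _≈_ = +ℂ._≈_ ; _+_ = +ℂ._∙_ ; _*_ = _*_ ; -_ = +ℂ._⁻¹ ; 0# = +ℂ.ε ; 1# = 1ℂ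
    ; isCommutativeRing = record
      { isRing = record
        { +-isAbelianGroup = +ℂ.isAbelianGroup
        ; *-cong = λ {z} {w} {u} {v} → *-cong {z} {w} {u} {v}
        ; *-assoc = *-assoc
        ; *-identity = *-identityˡ , λ z →
            +ℂ.trans {z * 1ℂ} {1ℂ * z} {z} (*-comm z 1ℂ) (*-identityˡ z)
        ; distrib = distribˡ , λ z w v →
            +ℂ.trans {(w +ℂ.∙ v) * z} {z * (w +ℂ.∙ v)} {(w * z) +ℂ.∙ (v * z)}
              (*-comm (w +ℂ.∙ v) z)
              (+ℂ.trans {z * (w +ℂ.∙ v)} {(z * w) +ℂ.∙ (z * v)} {(w * z) +ℂ.∙ (v * z)}
                (distribˡ z w v)
                (+ℂ.∙-cong {z * w} {w * z} {z * v} {v * z} (*-comm z w) (*-comm z v)))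
        }
      ; *-comm = *-comm
      }
    }

ℂ : CommutativeRing 0ℓ 0ℓ
ℂ = Complex.commutativeRing

module ℂ = CommutativeRing ℂ

IsPrimePower : ℕ → Set
IsPrimePower q = ∃₂ λ p k → Prime p × 1 ℕ.≤ k × q ≡ p ℕ.^ k

record FiniteField (c ℓ : Level) (q : ℕ) : Set (suc (c ⊔ ℓ)) where
  field
    commutativeRing : CommutativeRing c ℓ

  open CommutativeRing commutativeRing public

  field
    1≉0         : ¬ 1# ≈ 0#
    invertible  : ∀ x → ¬ x ≈ 0# → Invertible _≈_ 1# _*_ x
    enumeration : Inverse (≡.setoid (Fin q)) setoid

  element : Fin q → Carrier
  element = Inverse.to enumeration

  infix 4 _≟_

  _≟_ : Decidable _≈_
  _≟_ = via-injection (Inverse⇒Injection (inverse enumeration)) Fin._≟_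

  -- As usual in a total setting, x / 0 is 0.

  infixl 7 _/_

  _/_ : Carrier → Carrier → Carrier
  x / y with y ≟ 0#
  ... | yes _  = 0#
  ... | no y≉0 = x * proj₁ (invertible y y≉0)

-- An element of R^× carries its inverse, but equality only looks at the
-- element itself.

units : ∀ {c ℓ} → CommutativeRing c ℓ → AbelianGroup (c ⊔ ℓ) ℓ
units R = record
  { Carrier = ∃ (Invertible _≈_ 1# _*_)
  ; _≈_ = λ x y → proj₁ x ≈ proj₁ y
  ; _∙_ = λ (x , x⁻¹ , l , r) (y , y⁻¹ , l′ , r′) →
      x * y , x⁻¹ * y⁻¹
    , trans (interchange x⁻¹ y⁻¹ x y) (trans (*-cong l l′) (*-identityˡ 1#))
    , trans (interchange x y x⁻¹ y⁻¹) (trans (*-cong r r′) (*-identityˡ 1#))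
  ; ε = 1# , 1# , *-identityˡ 1# , *-identityˡ 1#
  ; _⁻¹ = λ (x , x⁻¹ , l , r) → x⁻¹ , x , r , l
  ; isAbelianGroup = record
    { isGroup = record
      { isMonoid = record
        { isSemigroup = record
          { isMagma = record
            { isEquivalence = record { refl = refl ; sym = sym ; trans = trans }
            ; ∙-cong = *-cong
            }
          ; assoc = λ x y z → *-assoc (proj₁ x) (proj₁ y) (proj₁ z)
          }
        ; identity = (λ x → *-identityˡ (proj₁ x)) , (λ x → *-identityʳ (proj₁ x))
        }
      ; inverse = (λ (_ , _ , l , _) → l) , (λ (_ , _ , _ , r) → r)
      ; ⁻¹-cong = λ {(x , x⁻¹ , l , _)} {(y , y⁻¹ , _ , r)} x≈y → begin
          x⁻¹               ≈⟨ *-identityʳ x⁻¹ ⟨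
          x⁻¹ * 1#          ≈⟨ *-congˡ r ⟨
          x⁻¹ * (y * y⁻¹)   ≈⟨ *-congˡ (*-congʳ x≈y) ⟨
          x⁻¹ * (x * y⁻¹)   ≈⟨ *-assoc x⁻¹ x y⁻¹ ⟨
          (x⁻¹ * x) * y⁻¹   ≈⟨ *-congʳ l ⟩
          1# * y⁻¹          ≈⟨ *-identityˡ y⁻¹ ⟩
          y⁻¹               ∎
      }
    ; comm = λ x y → *-comm (proj₁ x) (proj₁ y)
    }
  }
  where
  open CommutativeRing R
  open CommutativeSemigroupProperties *-commutativeSemigroup using (interchange)
  open import Relation.Binary.Reasoning.Setoid setoid

-- Multiplicative characters of a finite field F with values in a
-- commutative ring K, i.e. homomorphisms F^× → K^×.  The complex-valued
-- characters are the case K = ℂ.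

module Appell {c ℓ q} (F : FiniteField c ℓ q) {k ℓ′} (K : CommutativeRing k ℓ′) where

  open FiniteField F
  private
    module K  = CommutativeRing K
    module F* = AbelianGroup (units commutativeRing)
    module K* = AbelianGroup (units K)
    module K*-Properties = AbelianGroupProperties (units K)
    module K*-Interchange = CommutativeSemigroupProperties K*.commutativeSemigroup

  open GroupMorphisms F*.rawGroup K*.rawGroup using (IsGroupHomomorphism)

  record Character : Set (c ⊔ ℓ ⊔ k ⊔ ℓ′) where
    field
      ⟦_⟧                 : F*.Carrier → K*.Carrier
      isGroupHomomorphism : IsGroupHomomorphism ⟦_⟧

    open IsGroupHomomorphism isGroupHomomorphism public

  open Character using (⟦_⟧)

  infix  9 _⟨_⟩
  infixl 7 _∙_
  infix  8 _⁻¹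

  -- The value of χ, extended by 0, at an arbitrary element of F.

  _⟨_⟩ : Character → Carrier → K.Carrier
  χ ⟨ x ⟩ with x ≟ 0#
  ... | yes _  = K.0#
  ... | no x≉0 = proj₁ (⟦ χ ⟧ (x , invertible x x≉0))

  ε : Character
  ε = record
    { ⟦_⟧ = λ _ → K*.ε
    ; isGroupHomomorphism = record
      { isMonoidHomomorphism = record
        { isMagmaHomomorphism = record
          { isRelHomomorphism = record { cong = λ _ → K*.refl {K*.ε} }
          ; homo = λ _ _ → K*.sym {K*.ε K*.∙ K*.ε} {K*.ε} (K*.identityˡ K*.ε)
          }
        ; ε-homo = K*.refl {K*.ε}
        }
      ; ⁻¹-homo = λ _ → K*.refl {K*.ε}
      }
    }

  _∙_ : Character → Character → Character
  χ ∙ ψ = record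
    { ⟦_⟧ = λ x → ⟦ χ ⟧ x K*.∙ ⟦ ψ ⟧ x
    ; isGroupHomomorphism = record
      { isMonoidHomomorphism = record
        { isMagmaHomomorphism = record
          { isRelHomomorphism = record
            { cong = λ {x} {y} x≈y → K.*-cong (χ.⟦⟧-cong {x} {y} x≈y) (ψ.⟦⟧-cong {x} {y} x≈y) }
          ; homo = λ x y → K.trans (K.*-cong (χ.homo x y) (ψ.homo x y))
              (K*-Interchange.interchange (⟦ χ ⟧ x) (⟦ χ ⟧ y) (⟦ ψ ⟧ x) (⟦ ψ ⟧ y))
          }
        ; ε-homo = K.trans (K.*-cong χ.ε-homo ψ.ε-homo) (K.*-identityˡ K.1#)
        }
      ; ⁻¹-homo = λ x → K.*-cong (χ.⁻¹-homo x) (ψ.⁻¹-homo x)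
      }
    }
    where
    module χ = Character χ
    module ψ = Character ψ

  _⁻¹ : Character → Character
  χ ⁻¹ = record
    { ⟦_⟧ = λ x → ⟦ χ ⟧ x K*.⁻¹
    ; isGroupHomomorphism = record
      { isMonoidHomomorphism = record
        { isMagmaHomomorphism = record
          { isRelHomomorphism = record
            { cong = λ {x} {y} x≈y →
                K*.⁻¹-cong {⟦ χ ⟧ x} {⟦ χ ⟧ y} (χ.⟦⟧-cong {x} {y} x≈y) }
          ; homo = λ x y →
              K*.⁻¹-cong {⟦ χ ⟧ (x F*.∙ y)} {⟦ χ ⟧ x K*.∙ ⟦ χ ⟧ y} (χ.homo x y)
          }
        ; ε-homo = K*.⁻¹-cong {⟦ χ ⟧ F*.ε} {K*.ε} χ.ε-homo
        }
      ; ⁻¹-homo = λ x →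
          K*.⁻¹-cong {⟦ χ ⟧ (x F*.⁻¹)} {⟦ χ ⟧ x K*.⁻¹} (χ.⁻¹-homo x)
      }
    }
    where
    module χ = Character χ

  open Sum K.+-commutativeMonoid using (sum)

  ∑F : (Carrier → K.Carrier) → K.Carrier
  ∑F f = sum (λ i → f (element i))

  -- F₂ A B B′ C C′ x y  is  F₂(A; B, B′; C, C′; x, y).

  F₂ : (A B B′ C C′ : Character) → Carrier → Carrier → K.Carrier
  F₂ A B B′ C C′ x y =
    ε ⟨ x * y ⟩ K.* (B ∙ B′ ∙ C ∙ C′) ⟨ - 1# ⟩ K.*
    ∑F λ u → ∑F λ v →
      B ⟨ u ⟩ K.* B′ ⟨ v ⟩ K.* (B ⁻¹ ∙ C) ⟨ 1# - u ⟩ K.* (B′ ⁻¹ ∙ C′) ⟨ 1# - v ⟩ K.*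
      (A ⁻¹) ⟨ 1# - u * x - v * y ⟩

{-# OPTIONS --safe #-}

-- Each transformation is the substitution u ↦ 1 - u, v ↦ 1 - v, or both, in the
-- double sum: it exchanges B with B̄C (resp. B′ with B̄′C′), and the argument of Ā
-- becomes that of the transformed series after pulling out the factor 1 - x,
-- 1 - y or 1 - x - y.  The signs agree because χ(-1)² = 1.

module Submission where

open import Algebra.Bundles using (CommutativeRing; AbelianGroup)
import Algebra.Properties.CommutativeSemigroup as CommutativeSemigroupProperties
import Algebra.Properties.Ring as RingProperties
import Algebra.Properties.Semiring.Sum as Sum
import Algebra.Solver.CommutativeMonoid as CommutativeMonoidSolver
open import Data.Nat.Base using (ℕ)
open import Data.Product.Base using (∃; _×_; _,_; proj₁; proj₂)
open import Data.Unit.Base using (⊤; tt)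
open import Function.Base using (id)
open import Function.Bundles using (Inverse)
import Function.Construct.Composition as Composition
open import Function.Construct.Symmetry using (inverse)
open import Level using (_⊔_)
import Relation.Binary.Reasoning.Setoid as SetoidReasoning
open import Relation.Binary.PropositionalEquality as ≡ using (_≡_)
open import Relation.Nullary.Decidable using (yes; no)
open import Relation.Nullary.Negation using (¬_; contradiction)
open import Defs

-- Linear forms over a commutative ring

module RingLemmas {c ℓ} (R : CommutativeRing c ℓ) where

  open CommutativeRing R
  open RingProperties ring
  open CommutativeSemigroupProperties +-commutativeSemigroup using (xy∙z≈xz∙y)
  open CommutativeSemigroupProperties *-commutativeSemigroup using (x∙yz≈y∙xz)
  open SetoidReasoning setoid

  -‿swap : ∀ a b c → a - b - c ≈ a - c - b
  -‿swap a b c = xy∙z≈xz∙y a (- b) (- c)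

  x-0≈x : ∀ x → x - 0# ≈ x
  x-0≈x x = trans (+-congˡ -0#≈0#) (+-identityʳ x)

  -‿nested : ∀ a b c → a - (b - c) ≈ a - b + c
  -‿nested a b c = begin
    a - (b - c)       ≈⟨ +-congˡ (-‿+-comm b (- c)) ⟨
    a + (- b - - c)   ≈⟨ +-congˡ (+-congˡ (-‿involutive c)) ⟩
    a + (- b + c)     ≈⟨ +-assoc a (- b) c ⟨
    a - b + c         ∎

  1-[1-x]≈x : ∀ x → 1# - (1# - x) ≈ x
  1-[1-x]≈x x = begin
    1# - (1# - x)   ≈⟨ -‿nested 1# 1# x ⟩
    1# - 1# + x     ≈⟨ +-congʳ (-‿inverseʳ 1#) ⟩
    0# + x          ≈⟨ +-identityˡ x ⟩
    x               ∎

  -- Reflecting `u` moves `x` into the constant term and flips the sign of the coefficient. The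
  -- constant `a` is arbitrary so that it may already contain the term of the other variable.
  reflect-linear : ∀ a u x → a - (1# - u) * x ≈ a - x - u * - x
  reflect-linear a u x = begin
    a - (1# - u) * x       ≈⟨ +-congˡ (-‿cong ([y-z]x≈yx-zx x 1# u)) ⟩
    a - (1# * x - u * x)   ≈⟨ +-congˡ (-‿cong (+-congʳ (*-identityˡ x))) ⟩
    a - (x - u * x)        ≈⟨ -‿nested a x (u * x) ⟩
    a - x + u * x          ≈⟨ +-congˡ (-‿involutive (u * x)) ⟨
    a - x - - (u * x)      ≈⟨ +-congˡ (-‿cong (-‿distribʳ-* u x)) ⟩
    a - x - u * - x        ∎

  -- The new arguments `s` and `t` occur on the left only through `w * s` and `w * t`, so no
  -- division enters here.
  factor-linear : ∀ w u v s t →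
    w - u * (w * s) - v * (w * t) ≈ w * (1# - u * s - v * t)
  factor-linear w u v s t = sym (begin
    w * (1# - u * s - v * t)              ≈⟨ x[y-z]≈xy-xz w _ _ ⟩
    w * (1# - u * s) - w * (v * t)        ≈⟨ +-congʳ (x[y-z]≈xy-xz w _ _) ⟩
    w * 1# - w * (u * s) - w * (v * t)    ≈⟨ +-cong
      (+-cong (*-identityʳ w) (-‿cong (x∙yz≈y∙xz w u s))) (-‿cong (x∙yz≈y∙xz w v t)) ⟩
    w - u * (w * s) - v * (w * t)         ∎)

-- Units and division in the finite field

module FieldLemmas {c ℓ q} (F : FiniteField c ℓ q) where

  open FiniteField F
  open RingProperties ring
  open SetoidReasoning setoid

  unit⇒≉0 : (u : ∃ λ x → ∃ λ y → (y * x ≈ 1#) × (x * y ≈ 1#)) → ¬ proj₁ u ≈ 0#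
  unit⇒≉0 (x , y , _ , xy≈1) x≈0 =
    1≉0 (trans (sym xy≈1) (trans (*-congʳ x≈0) (zeroˡ y)))

  -1≉0 : ¬ - 1# ≈ 0#
  -1≉0 -1≈0 = 1≉0 (trans (sym (-‿involutive 1#)) (trans (-‿cong -1≈0) -0#≈0#))

  -- The convention x / 0 = 0 is excluded by the hypothesis; later arguments know division only
  -- through this cancellation.
  y*x/y≈x : ∀ x {y} → ¬ y ≈ 0# → y * (x / y) ≈ x
  y*x/y≈x x {y} y≉0 with y ≟ 0#
  ... | yes y≈0  = contradiction y≈0 y≉0
  ... | no y≉0′ with invertible y y≉0′
  ...   | y⁻¹ , _ , yy⁻¹≈1 = begin
    y * (x * y⁻¹)   ≈⟨ *-congˡ (*-comm x y⁻¹) ⟩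
    y * (y⁻¹ * x)   ≈⟨ *-assoc y y⁻¹ x ⟨
    y * y⁻¹ * x     ≈⟨ *-congʳ yy⁻¹≈1 ⟩
    1# * x          ≈⟨ *-identityˡ x ⟩
    x               ∎

  y*-[x/y]≈-x : ∀ x {y} → ¬ y ≈ 0# → y * - (x / y) ≈ - x
  y*-[x/y]≈-x x {y} y≉0 =
    trans (sym (-‿distribʳ-* y (x / y))) (-‿cong (y*x/y≈x x y≉0))

module AppellLemmas {c ℓ q} (F : FiniteField c ℓ q)
                    {k ℓ′} (K : CommutativeRing k ℓ′) where

  open FiniteField F
  open RingProperties ring using (-1*x≈-x; -‿involutive; x∙y⁻¹≈ε⇒x≈y; //-rightDividesˡ)
  open RingLemmas commutativeRing
  open FieldLemmas F
  open Appell F K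
  private
    module K  = CommutativeRing K
    module KΣ = Sum K.semiring
    module F* = AbelianGroup (units commutativeRing)
    module K* = AbelianGroup (units K)

  open Character using (⟦_⟧; ⟦⟧-cong; homo; ε-homo)
  open CommutativeMonoidSolver K.*-commutativeMonoid using (solve; _⊕_; _⊜_)
  open SetoidReasoning K.setoid

  -- Values of characters extended by zero

  ⟨⟩-zero : ∀ χ {x} → x ≈ 0# → χ ⟨ x ⟩ K.≈ K.0#
  ⟨⟩-zero χ {x} x≈0 with x ≟ 0#
  ... | yes _  = K.refl
  ... | no x≉0 = contradiction x≈0 x≉0

  -- The inverse supplied by `invertible` may differ from the one carried by `u`, but equality of
  -- units compares first components only, and these coincide.
  ⟨⟩-unit : ∀ χ (u : F*.Carrier) → χ ⟨ proj₁ u ⟩ K.≈ proj₁ (⟦ χ ⟧ u)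
  ⟨⟩-unit χ u with proj₁ u ≟ 0#
  ... | yes u≈0 = contradiction u≈0 (unit⇒≉0 u)
  ... | no u≉0  = ⟦⟧-cong χ {_ , invertible (proj₁ u) u≉0} {u} refl

  ⟨⟩-cong : ∀ χ {x y} → x ≈ y → χ ⟨ x ⟩ K.≈ χ ⟨ y ⟩
  ⟨⟩-cong χ {x} {y} x≈y with x ≟ 0# | y ≟ 0#
  ... | yes _   | yes _   = K.refl
  ... | yes x≈0 | no y≉0  = contradiction (trans (sym x≈y) x≈0) y≉0
  ... | no x≉0  | yes y≈0 = contradiction (trans x≈y y≈0) x≉0
  ... | no x≉0  | no y≉0  = ⟦⟧-cong χ {_ , invertible x x≉0} {_ , invertible y y≉0} x≈y

  ⟨⟩-* : ∀ χ x y → χ ⟨ x * y ⟩ K.≈ χ ⟨ x ⟩ K.* χ ⟨ y ⟩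
  ⟨⟩-* χ x y with x ≟ 0# | y ≟ 0#
  ... | yes x≈0 | _       = K.trans (⟨⟩-zero χ (trans (*-congʳ x≈0) (zeroˡ y)))
                                    (K.sym (K.zeroˡ _))
  ... | no _    | yes y≈0 = K.trans (⟨⟩-zero χ (trans (*-congˡ y≈0) (zeroʳ x)))
                                    (K.sym (K.zeroʳ _))
  -- The unit `x′ F*.∙ y′` carries the product of the two chosen inverses, and `⟨⟩-unit` accepts it
  -- in place of the inverse chosen for `x * y`.
  ... | no x≉0  | no y≉0  = K.trans (⟨⟩-unit χ (x′ F*.∙ y′)) (homo χ x′ y′)
    where
    x′ = x , invertible x x≉0
    y′ = y , invertible y y≉0

  ⟨1⟩≈1 : ∀ χ → χ ⟨ 1# ⟩ K.≈ K.1#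
  ⟨1⟩≈1 χ = K.trans (⟨⟩-unit χ F*.ε) (ε-homo χ)

  ⟨⟩-∙ : ∀ χ ψ x → (χ ∙ ψ) ⟨ x ⟩ K.≈ χ ⟨ x ⟩ K.* ψ ⟨ x ⟩
  ⟨⟩-∙ χ ψ x with x ≟ 0#
  ... | yes _ = K.sym (K.zeroˡ K.0#)
  ... | no _  = K.refl

  ⟨⟩-⁻¹-inverseˡ : ∀ χ {x} → ¬ x ≈ 0# → (χ ⁻¹) ⟨ x ⟩ K.* χ ⟨ x ⟩ K.≈ K.1#
  ⟨⟩-⁻¹-inverseˡ χ {x} x≉0 with x ≟ 0#
  ... | yes x≈0 = contradiction x≈0 x≉0
  ... | no x≉0′ = K*.inverseˡ (⟦ χ ⟧ (x , invertible x x≉0′))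

  -- Passing from B to B̄C is an involution: this is what lets the two factors of a weight trade
  -- places under reflection.
  [χ⁻¹∙ψ]⁻¹∙ψ : ∀ χ ψ x → ((χ ⁻¹ ∙ ψ) ⁻¹ ∙ ψ) ⟨ x ⟩ K.≈ χ ⟨ x ⟩
  [χ⁻¹∙ψ]⁻¹∙ψ χ ψ x with x ≟ 0#
  ... | yes _  = K.refl
  -- Inverting a unit swaps its two components, so the left side unfolds to χ(x) ψ̄(x) ψ(x).
  ... | no x≉0 = K.trans (K.*-assoc _ _ _)
    (K.trans (K.*-congˡ (K*.inverseˡ (⟦ ψ ⟧ (x , invertible x x≉0)))) (K.*-identityʳ _))

  ⟨-1⟩² : ∀ χ → χ ⟨ - 1# ⟩ K.* χ ⟨ - 1# ⟩ K.≈ K.1#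
  ⟨-1⟩² χ = begin
    χ ⟨ - 1# ⟩ K.* χ ⟨ - 1# ⟩   ≈⟨ ⟨⟩-* χ (- 1#) (- 1#) ⟨
    χ ⟨ - 1# * - 1# ⟩           ≈⟨ ⟨⟩-cong χ (trans (-1*x≈-x (- 1#)) (-‿involutive 1#)) ⟩
    χ ⟨ 1# ⟩                    ≈⟨ ⟨1⟩≈1 χ ⟩
    K.1#                        ∎

  -- A value whose square is 1 is its own inverse.
  ⟨-1⟩-⁻¹ : ∀ χ → (χ ⁻¹) ⟨ - 1# ⟩ K.≈ χ ⟨ - 1# ⟩
  ⟨-1⟩-⁻¹ χ = begin
    (χ ⁻¹) ⟨ - 1# ⟩                                   ≈⟨ K.*-identityʳ _ ⟨
    (χ ⁻¹) ⟨ - 1# ⟩ K.* K.1#                          ≈⟨ K.*-congˡ (⟨-1⟩² χ) ⟨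
    (χ ⁻¹) ⟨ - 1# ⟩ K.* (χ ⟨ - 1# ⟩ K.* χ ⟨ - 1# ⟩)   ≈⟨ K.*-assoc _ _ _ ⟨
    (χ ⁻¹) ⟨ - 1# ⟩ K.* χ ⟨ - 1# ⟩ K.* χ ⟨ - 1# ⟩     ≈⟨ K.*-congʳ (⟨⟩-⁻¹-inverseˡ χ -1≉0) ⟩
    K.1# K.* χ ⟨ - 1# ⟩                               ≈⟨ K.*-identityˡ _ ⟩
    χ ⟨ - 1# ⟩                                        ∎

  -- The trivial character only records whether its argument is zero.
  ε-scale : ∀ {w} x → ¬ w ≈ 0# → ε ⟨ w * x ⟩ K.≈ ε ⟨ x ⟩
  ε-scale {w} x w≉0 = begin
    ε ⟨ w * x ⟩           ≈⟨ ⟨⟩-* ε w x ⟩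
    ε ⟨ w ⟩ K.* ε ⟨ x ⟩   ≈⟨ K.*-congʳ (⟨⟩-unit ε (w , invertible w w≉0)) ⟩
    K.1# K.* ε ⟨ x ⟩      ≈⟨ K.*-identityˡ _ ⟩
    ε ⟨ x ⟩               ∎

  -- Sums over the field and their reindexing

  ∑F-cong : ∀ {f g} → (∀ x → f x K.≈ g x) → ∑F f K.≈ ∑F g
  ∑F-cong f≈g = KΣ.sum-cong-≋ (λ i → f≈g (element i))

  *-distribˡ-∑F : ∀ a f → a K.* ∑F f K.≈ ∑F (λ x → a K.* f x)
  *-distribˡ-∑F a f = KΣ.*-distribˡ-sum a (λ i → f (element i))

  -- Conjugating `π` by the enumeration gives a permutation of the index set. Returning to the field
  -- recovers `π` only up to `_≈_`, hence the hypothesis that `f` respects it.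
  ∑F-permute : (π : Inverse setoid setoid) → ∀ f → (∀ {x y} → x ≈ y → f x K.≈ f y) →
               ∑F f K.≈ ∑F (λ x → f (Inverse.to π x))
  ∑F-permute π f f-cong = K.trans
    (KΣ.sum-permute (λ i → f (element i))
      (Composition.inverse enumeration (Composition.inverse π (inverse enumeration))))
    (KΣ.sum-cong-≋ (λ i → f-cong
      (Inverse.strictlyInverseˡ enumeration (Inverse.to π (element i)))))

  reflection : Inverse setoid setoid
  reflection = record
    { to        = λ x → 1# - x
    ; from      = λ x → 1# - x
    ; to-cong   = λ x≈y → +-congˡ (-‿cong x≈y)
    ; from-cong = λ x≈y → +-congˡ (-‿cong x≈y)
    ; inverse   = cancel , cancel
    }
    where
    cancel : ∀ {x y} → y ≈ 1# - x → 1# - y ≈ x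
    cancel {x} y≈1-x = trans (+-congˡ (-‿cong y≈1-x)) (1-[1-x]≈x x)

  -- The summand grouped by variable, and substitutions in one variable

  weight : Character → Character → Carrier → K.Carrier
  weight C B u = B ⟨ u ⟩ K.* (B ⁻¹ ∙ C) ⟨ 1# - u ⟩

  weight-cong : ∀ C B {u u′} → u ≈ u′ → weight C B u K.≈ weight C B u′
  weight-cong C B u≈u′ =
    K.*-cong (⟨⟩-cong B u≈u′) (⟨⟩-cong (B ⁻¹ ∙ C) (+-congˡ (-‿cong u≈u′)))

  -- Grouped so that a change of `u` affects only the first weight and the linear form, and likewise
  -- for `v` and the second weight.
  summand : (A B B′ C C′ : Character) (x y u v : Carrier) → K.Carrier
  summand A B B′ C C′ x y u v =
    weight C B u K.* weight C′ B′ v K.* (A ⁻¹) ⟨ 1# - u * x - v * y ⟩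

  summand-cong : ∀ A B B′ C C′ x y {u u′ v v′} → u ≈ u′ → v ≈ v′ →
    summand A B B′ C C′ x y u v K.≈ summand A B B′ C C′ x y u′ v′
  summand-cong A B B′ C C′ x y u≈u′ v≈v′ = K.*-cong
    (K.*-cong (weight-cong C B u≈u′) (weight-cong C′ B′ v≈v′))
    (⟨⟩-cong (A ⁻¹) (+-cong (+-congˡ (-‿cong (*-congʳ u≈u′))) (-‿cong (*-congʳ v≈v′))))

  F₂≈∑∑summand : ∀ A B B′ C C′ x y → F₂ A B B′ C C′ x y K.≈
    ε ⟨ x * y ⟩ K.* (B ∙ B′ ∙ C ∙ C′) ⟨ - 1# ⟩ K.*
    ∑F λ u → ∑F λ v → summand A B B′ C C′ x y u v
  F₂≈∑∑summand A B B′ C C′ x y = K.*-congˡ (∑F-cong λ u → ∑F-cong λ v →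
    solve 5 (λ b b′ d d′ a → (((b ⊕ b′) ⊕ d) ⊕ d′) ⊕ a ⊜ ((b ⊕ d) ⊕ (b′ ⊕ d′)) ⊕ a)
      K.refl (B ⟨ u ⟩) (B′ ⟨ v ⟩) ((B ⁻¹ ∙ C) ⟨ 1# - u ⟩) ((B′ ⁻¹ ∙ C′) ⟨ 1# - v ⟩)
      ((A ⁻¹) ⟨ 1# - u * x - v * y ⟩))

  -- A change of one summation variable turning the parameters (B , x) into
  -- (D , x′), where u x is replaced by δ + u x′ and κ is the resulting sign.

  record Substitution (C B D : Character) (κ : K.Carrier) (x x′ δ : Carrier)
                      : Set (c ⊔ ℓ ⊔ k ⊔ ℓ′) where
    field
      permutation : Inverse setoid setoid

    open Inverse permutation public using () renaming (to to σ)

    field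
      weight-σ : ∀ u → weight C B (σ u) K.≈ weight C D u
      linear-σ : ∀ a u → a - σ u * x ≈ a - δ - u * x′
      sign     : κ K.* D ⟨ - 1# ⟩ K.≈ B ⟨ - 1# ⟩
      support  : ε ⟨ x ⟩ K.≈ ε ⟨ x′ ⟩

  -- The trivial substitution makes the one-variable transformations instances of the same
  -- two-variable result, with sign 1 and shift 0.
  keep : ∀ C B x → Substitution C B B K.1# x x 0#
  keep C B x = record
    { permutation = record
      { to = id ; from = id ; to-cong = id ; from-cong = id ; inverse = id , id }
    ; weight-σ = λ _ → K.refl
    ; linear-σ = λ a u → +-congʳ (sym (x-0≈x a))
    ; sign     = K.*-identityˡ _
    ; support  = K.refl
    }

  -- The sign is C(-1) because C(-1) B̄C(-1) = B̄(-1) = B(-1), both C(-1)² and B(-1)² being 1.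
  reflect : ∀ C B x → Substitution C B (B ⁻¹ ∙ C) (C ⟨ - 1# ⟩) x (- x) x
  reflect C B x = record
    { permutation = reflection
    ; weight-σ = λ u → begin
        B ⟨ 1# - u ⟩ K.* (B ⁻¹ ∙ C) ⟨ 1# - (1# - u) ⟩
          ≈⟨ K.*-comm _ _ ⟩
        (B ⁻¹ ∙ C) ⟨ 1# - (1# - u) ⟩ K.* B ⟨ 1# - u ⟩
          ≈⟨ K.*-cong (⟨⟩-cong (B ⁻¹ ∙ C) (1-[1-x]≈x u))
                      (K.sym ([χ⁻¹∙ψ]⁻¹∙ψ B C (1# - u))) ⟩
        (B ⁻¹ ∙ C) ⟨ u ⟩ K.* ((B ⁻¹ ∙ C) ⁻¹ ∙ C) ⟨ 1# - u ⟩
          ∎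
    ; linear-σ = λ a u → reflect-linear a u x
    ; sign = begin
        C ⟨ - 1# ⟩ K.* (B ⁻¹ ∙ C) ⟨ - 1# ⟩
          ≈⟨ K.*-congˡ (⟨⟩-∙ (B ⁻¹) C (- 1#)) ⟩
        C ⟨ - 1# ⟩ K.* ((B ⁻¹) ⟨ - 1# ⟩ K.* C ⟨ - 1# ⟩)
          ≈⟨ solve 2 (λ c b → c ⊕ (b ⊕ c) ⊜ b ⊕ (c ⊕ c)) K.refl _ _ ⟩
        (B ⁻¹) ⟨ - 1# ⟩ K.* (C ⟨ - 1# ⟩ K.* C ⟨ - 1# ⟩)
          ≈⟨ K.*-cong (⟨-1⟩-⁻¹ B) (⟨-1⟩² C) ⟩
        B ⟨ - 1# ⟩ K.* K.1#
          ≈⟨ K.*-identityʳ _ ⟩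
        B ⟨ - 1# ⟩
          ∎
    -- Here -x is `x` scaled by the nonzero element -1.
    ; support = K.trans (K.sym (ε-scale x -1≉0)) (⟨⟩-cong ε (-1*x≈-x x))
    }

  sign-∙ : ∀ B B′ C C′ → (B ∙ B′ ∙ C ∙ C′) ⟨ - 1# ⟩ K.≈
    B ⟨ - 1# ⟩ K.* B′ ⟨ - 1# ⟩ K.* (C ⟨ - 1# ⟩ K.* C′ ⟨ - 1# ⟩)
  sign-∙ B B′ C C′ = begin
    (B ∙ B′ ∙ C ∙ C′) ⟨ - 1# ⟩
      ≈⟨ ⟨⟩-∙ (B ∙ B′ ∙ C) C′ (- 1#) ⟩
    (B ∙ B′ ∙ C) ⟨ - 1# ⟩ K.* C′ ⟨ - 1# ⟩
      ≈⟨ K.*-congʳ (⟨⟩-∙ (B ∙ B′) C (- 1#)) ⟩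
    (B ∙ B′) ⟨ - 1# ⟩ K.* C ⟨ - 1# ⟩ K.* C′ ⟨ - 1# ⟩
      ≈⟨ K.*-assoc _ _ _ ⟩
    (B ∙ B′) ⟨ - 1# ⟩ K.* (C ⟨ - 1# ⟩ K.* C′ ⟨ - 1# ⟩)
      ≈⟨ K.*-congʳ (⟨⟩-∙ B B′ (- 1#)) ⟩
    B ⟨ - 1# ⟩ K.* B′ ⟨ - 1# ⟩ K.* (C ⟨ - 1# ⟩ K.* C′ ⟨ - 1# ⟩)
      ∎

  -- Two substitutions carried out together

  module _ {B B′ C C′ D D′ κ κ′ x x′ δ y y′ δ′}
           (S : Substitution C B D κ x x′ δ) (S′ : Substitution C′ B′ D′ κ′ y y′ δ′)
           {w s t} (w≈1-δ-δ′ : w ≈ 1# - δ - δ′) (w≉0 : ¬ w ≈ 0#)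
           (ws≈x′ : w * s ≈ x′) (wt≈y′ : w * t ≈ y′) where

    private
      module S  = Substitution S
      module S′ = Substitution S′

    -- The first substitution acts with constant 1, the second with constant 1 - δ - u x′.
    -- Collecting δ and δ′ next to 1 produces `w`, which then factors out.
    linear-substitution : ∀ u v →
      1# - S.σ u * x - S′.σ v * y ≈ w * (1# - u * s - v * t)
    linear-substitution u v =
      trans (+-congʳ (S.linear-σ 1# u)) (
      trans (S′.linear-σ (1# - δ - u * x′) v) (
      trans (+-congʳ (-‿swap (1# - δ) (u * x′) δ′)) (
      trans (+-cong (+-cong (sym w≈1-δ-δ′) (-‿cong (*-congˡ (sym ws≈x′))))
                    (-‿cong (*-congˡ (sym wt≈y′))))
            (factor-linear w u v s t))))

    summand-substitution : ∀ A u v →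
      summand A B B′ C C′ x y (S.σ u) (S′.σ v) K.≈
      (A ⁻¹) ⟨ w ⟩ K.* summand A D D′ C C′ s t u v
    summand-substitution A u v = begin
      weight C B (S.σ u) K.* weight C′ B′ (S′.σ v) K.*
      (A ⁻¹) ⟨ 1# - S.σ u * x - S′.σ v * y ⟩
        ≈⟨ K.*-cong (K.*-cong (S.weight-σ u) (S′.weight-σ v))
             (K.trans (⟨⟩-cong (A ⁻¹) (linear-substitution u v)) (⟨⟩-* (A ⁻¹) w _)) ⟩
      weight C D u K.* weight C′ D′ v K.*
      ((A ⁻¹) ⟨ w ⟩ K.* (A ⁻¹) ⟨ 1# - u * s - v * t ⟩)
        ≈⟨ solve 3 (λ m a b → m ⊕ (a ⊕ b) ⊜ a ⊕ (m ⊕ b)) K.refl _ _ _ ⟩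
      (A ⁻¹) ⟨ w ⟩ K.* summand A D D′ C C′ s t u v
        ∎

    ∑∑-substitution : ∀ A →
      (∑F λ u → ∑F λ v → summand A B B′ C C′ x y u v) K.≈
      (A ⁻¹) ⟨ w ⟩ K.* ∑F λ u → ∑F λ v → summand A D D′ C C′ s t u v
    ∑∑-substitution A = begin
      (∑F λ u → ∑F λ v → f u v)
        ≈⟨ ∑F-permute S.permutation (λ u → ∑F (f u))
             (λ u≈u′ → ∑F-cong λ v → f-cong u≈u′ (refl {v})) ⟩
      (∑F λ u → ∑F λ v → f (S.σ u) v)
        ≈⟨ (∑F-cong λ u → ∑F-permute S′.permutation (f (S.σ u))
             (λ v≈v′ → f-cong (refl {S.σ u}) v≈v′)) ⟩
      (∑F λ u → ∑F λ v → f (S.σ u) (S′.σ v))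
        ≈⟨ (∑F-cong λ u → ∑F-cong λ v → summand-substitution A u v) ⟩
      (∑F λ u → ∑F λ v → a K.* g u v)
        ≈⟨ (∑F-cong λ u → *-distribˡ-∑F a (g u)) ⟨
      (∑F λ u → a K.* ∑F λ v → g u v)
        ≈⟨ *-distribˡ-∑F a (λ u → ∑F λ v → g u v) ⟨
      (a K.* ∑F λ u → ∑F λ v → g u v)
        ∎
      where
      f = summand A B B′ C C′ x y
      g = summand A D D′ C C′ s t
      a = (A ⁻¹) ⟨ w ⟩
      f-cong : ∀ {u u′ v v′} → u ≈ u′ → v ≈ v′ → f u v K.≈ f u′ v′
      f-cong = summand-cong A B B′ C C′ x y

    -- Multiplicativity separates the variables; each then passes through its own substitution and a
    -- rescaling by the nonzero `w`.
    support-substitution : ε ⟨ x * y ⟩ K.≈ ε ⟨ s * t ⟩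
    support-substitution = begin
      ε ⟨ x * y ⟩                   ≈⟨ ⟨⟩-* ε x y ⟩
      ε ⟨ x ⟩ K.* ε ⟨ y ⟩           ≈⟨ K.*-cong S.support S′.support ⟩
      ε ⟨ x′ ⟩ K.* ε ⟨ y′ ⟩         ≈⟨ K.*-cong (⟨⟩-cong ε ws≈x′) (⟨⟩-cong ε wt≈y′) ⟨
      ε ⟨ w * s ⟩ K.* ε ⟨ w * t ⟩   ≈⟨ K.*-cong (ε-scale s w≉0) (ε-scale t w≉0) ⟩
      ε ⟨ s ⟩ K.* ε ⟨ t ⟩           ≈⟨ ⟨⟩-* ε s t ⟨
      ε ⟨ s * t ⟩                   ∎

    sign-substitution :
      (B ∙ B′ ∙ C ∙ C′) ⟨ - 1# ⟩ K.≈ κ K.* κ′ K.* (D ∙ D′ ∙ C ∙ C′) ⟨ - 1# ⟩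
    sign-substitution = begin
      (B ∙ B′ ∙ C ∙ C′) ⟨ - 1# ⟩
        ≈⟨ sign-∙ B B′ C C′ ⟩
      B ⟨ - 1# ⟩ K.* B′ ⟨ - 1# ⟩ K.* (C ⟨ - 1# ⟩ K.* C′ ⟨ - 1# ⟩)
        ≈⟨ K.*-congʳ (K.*-cong S.sign S′.sign) ⟨
      (κ K.* D ⟨ - 1# ⟩) K.* (κ′ K.* D′ ⟨ - 1# ⟩) K.* (C ⟨ - 1# ⟩ K.* C′ ⟨ - 1# ⟩)
        ≈⟨ solve 5 (λ k d k′ d′ e → ((k ⊕ d) ⊕ (k′ ⊕ d′)) ⊕ e ⊜ (k ⊕ k′) ⊕ ((d ⊕ d′) ⊕ e))
             K.refl _ _ _ _ _ ⟩
      κ K.* κ′ K.* (D ⟨ - 1# ⟩ K.* D′ ⟨ - 1# ⟩ K.* (C ⟨ - 1# ⟩ K.* C′ ⟨ - 1# ⟩))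
        ≈⟨ K.*-congˡ (sign-∙ D D′ C C′) ⟨
      κ K.* κ′ K.* (D ∙ D′ ∙ C ∙ C′) ⟨ - 1# ⟩
        ∎

    F₂-substitution : ∀ A → F₂ A B B′ C C′ x y K.≈
      κ K.* κ′ K.* (A ⁻¹) ⟨ w ⟩ K.* F₂ A D D′ C C′ s t
    F₂-substitution A = begin
      F₂ A B B′ C C′ x y
        ≈⟨ F₂≈∑∑summand A B B′ C C′ x y ⟩
      ε ⟨ x * y ⟩ K.* (B ∙ B′ ∙ C ∙ C′) ⟨ - 1# ⟩ K.*
      (∑F λ u → ∑F λ v → summand A B B′ C C′ x y u v)
        ≈⟨ K.*-cong (K.*-cong support-substitution sign-substitution) (∑∑-substitution A) ⟩
      ε ⟨ s * t ⟩ K.* (κ K.* κ′ K.* (D ∙ D′ ∙ C ∙ C′) ⟨ - 1# ⟩) K.*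
      ((A ⁻¹) ⟨ w ⟩ K.* ∑F λ u → ∑F λ v → summand A D D′ C C′ s t u v)
        ≈⟨ solve 5 (λ e k m a S → (e ⊕ (k ⊕ m)) ⊕ (a ⊕ S) ⊜ (k ⊕ a) ⊕ ((e ⊕ m) ⊕ S))
             K.refl _ _ _ _ _ ⟩
      κ K.* κ′ K.* (A ⁻¹) ⟨ w ⟩ K.*
      (ε ⟨ s * t ⟩ K.* (D ∙ D′ ∙ C ∙ C′) ⟨ - 1# ⟩ K.*
       ∑F λ u → ∑F λ v → summand A D D′ C C′ s t u v)
        ≈⟨ K.*-congˡ (F₂≈∑∑summand A D D′ C C′ s t) ⟨
      κ K.* κ′ K.* (A ⁻¹) ⟨ w ⟩ K.* F₂ A D D′ C C′ s t
        ∎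

  -- Over ℂ, comparing two characters definitionally unfolds the Cauchy moduli of
  -- their values, which is infeasible.  The results below are therefore stated with
  -- every parameter of the right-hand side free (including the character χ in the
  -- sign of F₂, by which F₂ˢ differs from F₂), so that unification can read the
  -- parameters off a goal; they are then related to B, C, x, … up to _≋_ and _≈_.

  F₂ˢ : (χ A B B′ C C′ : Character) → Carrier → Carrier → K.Carrier
  F₂ˢ χ A B B′ C C′ x y =
    ε ⟨ x * y ⟩ K.* χ ⟨ - 1# ⟩ K.*
    ∑F λ u → ∑F λ v →
      B ⟨ u ⟩ K.* B′ ⟨ v ⟩ K.* (B ⁻¹ ∙ C) ⟨ 1# - u ⟩ K.* (B′ ⁻¹ ∙ C′) ⟨ 1# - v ⟩ K.*
      (A ⁻¹) ⟨ 1# - u * x - v * y ⟩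

  infix 4 _≋_

  -- Agreement on units is enough, since all characters vanish at 0; the inverses carried by the
  -- values are ignored.
  _≋_ : Character → Character → Set (c ⊔ ℓ ⊔ ℓ′)
  χ ≋ ψ = ∀ u → proj₁ (⟦ χ ⟧ u) K.≈ proj₁ (⟦ ψ ⟧ u)

  ≋-refl : ∀ χ → χ ≋ χ
  ≋-refl _ _ = K.refl

  ⟨⟩-cong-≋ : ∀ χ ψ → χ ≋ ψ → ∀ {x y} → x ≈ y → χ ⟨ x ⟩ K.≈ ψ ⟨ y ⟩
  ⟨⟩-cong-≋ χ ψ χ≋ψ {x} {y} x≈y = K.trans (⟨⟩-cong χ x≈y) pointwise
    where
    pointwise : χ ⟨ y ⟩ K.≈ ψ ⟨ y ⟩
    pointwise with y ≟ 0#
    ... | yes _  = K.refl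
    ... | no y≉0 = χ≋ψ (y , invertible y y≉0)

  complement-cong-≋ : ∀ χ ψ C → χ ≋ ψ → χ ⁻¹ ∙ C ≋ ψ ⁻¹ ∙ C
  complement-cong-≋ χ ψ C χ≋ψ u =
    K.*-congʳ (K*.⁻¹-cong {⟦ χ ⟧ u} {⟦ ψ ⟧ u} (χ≋ψ u))

  -- Propositional equality, so that matching on `≡.refl` replaces χ by the product and `F₂ˢ`
  -- becomes `F₂`.
  Product : (χ B B′ C C′ : Character) → Set (c ⊔ ℓ ⊔ k ⊔ ℓ′)
  Product χ B B′ C C′ = χ ≡ B ∙ B′ ∙ C ∙ C′

  F₂ˢ-cong : ∀ {A B B′ C C′ D D′ χ x y s t} → Product χ D D′ C C′ →
    D ≋ B → D′ ≋ B′ → s ≈ x → t ≈ y →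
    F₂ A B B′ C C′ x y K.≈ F₂ˢ χ A D D′ C C′ s t
  F₂ˢ-cong {A} {B} {B′} {C} {C′} {D} {D′} {_} {x} {y} {s} {t} ≡.refl D≋B D′≋B′ s≈x t≈y =
    K.sym (K.*-cong
      (K.*-cong (⟨⟩-cong ε (*-cong s≈x t≈y)) (⟨⟩-cong-≋ (D ∙ D′ ∙ C ∙ C′) (B ∙ B′ ∙ C ∙ C′) sign≋ refl))
      (∑F-cong λ u → ∑F-cong λ v →
        K.*-cong (K.*-cong (K.*-cong (K.*-cong
          (⟨⟩-cong-≋ D B D≋B (refl {u}))
          (⟨⟩-cong-≋ D′ B′ D′≋B′ (refl {v})))
          (⟨⟩-cong-≋ (D ⁻¹ ∙ C) (B ⁻¹ ∙ C) (complement-cong-≋ D B C D≋B) (refl {1# - u})))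
          (⟨⟩-cong-≋ (D′ ⁻¹ ∙ C′) (B′ ⁻¹ ∙ C′) (complement-cong-≋ D′ B′ C′ D′≋B′) (refl {1# - v})))
          (⟨⟩-cong (A ⁻¹) (+-cong (+-congˡ (-‿cong (*-congˡ {u} s≈x))) (-‿cong (*-congˡ {v} t≈y))))))
    where
    sign≋ : D ∙ D′ ∙ C ∙ C′ ≋ B ∙ B′ ∙ C ∙ C′
    sign≋ u = K.*-congʳ (K.*-congʳ (K.*-cong (D≋B u) (D′≋B′ u)))

  -- The three transformations

  module _ (A B B′ C C′ : Character) (x y : Carrier) where

    F₂-reflectˡ : ∀ {α D χ m w s t} → Product χ D B′ C C′ → α ≋ A ⁻¹ → D ≋ B ⁻¹ ∙ C →
      m ≈ - 1# → w ≈ 1# - x → s ≈ - (x / w) → t ≈ y / w →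
      ¬ x ≈ 1# → F₂ A B B′ C C′ x y K.≈
      C ⟨ m ⟩ K.* α ⟨ w ⟩ K.* F₂ˢ χ A D B′ C C′ s t
    F₂-reflectˡ {α} {D} {w = w} χ≡ α≋ D≋ m≈ w≈ s≈ t≈ x≉1 = K.trans
      (F₂-substitution (reflect C B x) (keep C′ B′ y)
        -- The shifts are δ = x from the reflected variable and δ′ = 0 from the kept one.
        (trans w≈ (sym (x-0≈x (1# - x)))) w≉0 (y*-[x/y]≈-x x w≉0) (y*x/y≈x y w≉0) A)
      (K.*-cong
        (K.*-cong (K.trans (K.*-identityʳ _) (⟨⟩-cong C (sym m≈)))
                  (K.sym (⟨⟩-cong-≋ α (A ⁻¹) α≋ refl)))
        (F₂ˢ-cong {A} {B ⁻¹ ∙ C} {B′} {C} {C′} {D} {B′} χ≡ D≋ (≋-refl B′) s≈ t≈))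
      where
      w≉0 : ¬ w ≈ 0#
      w≉0 w≈0 = x≉1 (sym (x∙y⁻¹≈ε⇒x≈y 1# x (trans (sym w≈) w≈0)))

    F₂-reflectʳ : ∀ {α D′ χ m w s t} → Product χ B D′ C C′ → α ≋ A ⁻¹ → D′ ≋ B′ ⁻¹ ∙ C′ →
      m ≈ - 1# → w ≈ 1# - y → s ≈ x / w → t ≈ - (y / w) →
      ¬ y ≈ 1# → F₂ A B B′ C C′ x y K.≈
      C′ ⟨ m ⟩ K.* α ⟨ w ⟩ K.* F₂ˢ χ A B D′ C C′ s t
    F₂-reflectʳ {α} {D′} {w = w} χ≡ α≋ D′≋ m≈ w≈ s≈ t≈ y≉1 = K.trans
      (F₂-substitution (keep C B x) (reflect C′ B′ y)
        (trans w≈ (+-congʳ (sym (x-0≈x 1#)))) w≉0 (y*x/y≈x x w≉0) (y*-[x/y]≈-x y w≉0) A)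
      (K.*-cong
        (K.*-cong (K.trans (K.*-identityˡ _) (⟨⟩-cong C′ (sym m≈)))
                  (K.sym (⟨⟩-cong-≋ α (A ⁻¹) α≋ refl)))
        (F₂ˢ-cong {A} {B} {B′ ⁻¹ ∙ C′} {C} {C′} {B} {D′} χ≡ (≋-refl B) D′≋ s≈ t≈))
      where
      w≉0 : ¬ w ≈ 0#
      w≉0 w≈0 = y≉1 (sym (x∙y⁻¹≈ε⇒x≈y 1# y (trans (sym w≈) w≈0)))

    F₂-reflect-both : ∀ {κ α D D′ χ m w s t} → Product χ D D′ C C′ → κ ≋ C ∙ C′ → α ≋ A ⁻¹ →
      D ≋ B ⁻¹ ∙ C → D′ ≋ B′ ⁻¹ ∙ C′ →
      m ≈ - 1# → w ≈ 1# - x - y → s ≈ - (x / w) → t ≈ - (y / w) →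
      ¬ x + y ≈ 1# → F₂ A B B′ C C′ x y K.≈
      κ ⟨ m ⟩ K.* α ⟨ w ⟩ K.* F₂ˢ χ A D D′ C C′ s t
    F₂-reflect-both {κ} {α} {D} {D′} {w = w} χ≡ κ≋ α≋ D≋ D′≋ m≈ w≈ s≈ t≈ x+y≉1 = K.trans
      (F₂-substitution (reflect C B x) (reflect C′ B′ y) w≈ w≉0
        (y*-[x/y]≈-x x w≉0) (y*-[x/y]≈-x y w≉0) A)
      (K.*-cong
        (K.*-cong (K.sym (K.trans (⟨⟩-cong-≋ κ (C ∙ C′) κ≋ m≈) (⟨⟩-∙ C C′ (- 1#))))
                  (K.sym (⟨⟩-cong-≋ α (A ⁻¹) α≋ refl)))
        (F₂ˢ-cong {A} {B ⁻¹ ∙ C} {B′ ⁻¹ ∙ C′} {C} {C′} {D} {D′} χ≡ D≋ D′≋ s≈ t≈))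
      where
      w≉0 : ¬ w ≈ 0#
      -- If w = 0 then 1 - x = y, and adding `x` back gives 1 = y + x.
      w≉0 w≈0 = x+y≉1 (sym (trans (sym (//-rightDividesˡ x 1#))
        (trans (+-congʳ (x∙y⁻¹≈ε⇒x≈y (1# - x) y (trans (sym w≈) w≈0))) (+-comm y x))))

-- Placing the argument last makes Agda match the goal before it checks f.

apply : ∀ {a b} {A : Set a} {B : A → Set b} → ⊤ → (∀ x → B x) → ∀ x → B x
apply _ f x = f x

theorem3p4 : ∀ {c ℓ} (q : ℕ) → IsPrimePower q → (F : FiniteField c ℓ q) →
    let open FiniteField F
        open Appell F ℂ
    in (A B B′ C C′ : Character) (x y : Carrier) →
      (¬ x ≈ 1# →
        F₂ A B B′ C C′ x y
          ℂ.≈ C ⟨ - 1# ⟩ ℂ.* (A ⁻¹) ⟨ 1# - x ⟩ ℂ.*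
              F₂ A (B ⁻¹ ∙ C) B′ C C′ (- (x / (1# - x))) (y / (1# - x)))
      ×
      (¬ y ≈ 1# →
        F₂ A B B′ C C′ x y
          ℂ.≈ C′ ⟨ - 1# ⟩ ℂ.* (A ⁻¹) ⟨ 1# - y ⟩ ℂ.*
              F₂ A B (B′ ⁻¹ ∙ C′) C C′ (x / (1# - y)) (- (y / (1# - y))))
      ×
      (¬ x + y ≈ 1# →
        F₂ A B B′ C C′ x y
          ℂ.≈ (C ∙ C′) ⟨ - 1# ⟩ ℂ.* (A ⁻¹) ⟨ 1# - x - y ⟩ ℂ.*
              F₂ A (B ⁻¹ ∙ C) (B′ ⁻¹ ∙ C′) C C′
                (- (x / (1# - x - y))) (- (y / (1# - x - y))))
theorem3p4 q _ F A B B′ C C′ x y =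
    -- Once the goal has fixed the free parameters, every comparison hypothesis is an instance of
    -- reflexivity.
    apply tt (F₂-reflectˡ A B B′ C C′ x y ≡.refl (≋-refl (A ⁻¹)) (≋-refl (B ⁻¹ ∙ C))
      refl refl refl refl)
  , apply tt (F₂-reflectʳ A B B′ C C′ x y ≡.refl (≋-refl (A ⁻¹)) (≋-refl (B′ ⁻¹ ∙ C′))
      refl refl refl refl)
  , apply tt (F₂-reflect-both A B B′ C C′ x y ≡.refl (≋-refl (C ∙ C′)) (≋-refl (A ⁻¹))
      (≋-refl (B ⁻¹ ∙ C)) (≋-refl (B′ ⁻¹ ∙ C′)) refl refl refl refl)
  where
  open FiniteField F
  open Appell F Complex.commutativeRing
  open AppellLemmas F Complex.commutativeRing
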